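{- Let $\mathbf{A}$ be a finite algebra belonging to some dual discriminator variety, and let $\theta_1,\ldots,\theta_k$ be congruences of $\mathbf{A}$. Let $\Sigma$ be the set of meet-irreducible congruences of $\mathbf{A}$ that contain $\bigcap_{j=1}^k\theta_j$. The following are equivalent: 1. $\langle\theta_1,\ldots,\theta_k\rangle$ is a CR tuple of $\mathbf{A}$. 2. For all $\lambda,\mu\in\Sigma$ one of the following conditions holds: - $\lambda\circ\mu=\mu\circ\lambda$; - there is $\sigma\in\Sigma\setminus\{\lambda,\mu\}$ with $\sigma\subseteq\lambda\circ\mu$; - there is $j\in\{1,\ldots,k\}$ such that $\theta_j\subseteq\lambda\cap\mu$.
   Context: The join $\theta\vee\delta$ of two congruences of an algebra is the transitive closure of $\theta\cup\delta$. A tuple $\langle\theta_1,\ldots,\theta_k\rangle$ of congruences of $\mathbf{A}$ is a Chinese Remainder tuple (CR tuple) of $\mathbf{A}$ if for all $a_1,\ldots,a_k\in A$ with $\langle a_i,a_j\rangle\in\theta_i\vee\theta_j$ for all $i,j$ there is $a\in A$ with $\langle a,a_i\rangle\in\theta_i$ for all $i$. The dual discriminator on a set $A$ is the function $q_A:A^3\to A$ with $q_A(a,b,c)=a$ if $a=b$ and $q_A(a,b,c)=c$ if $a\ne b$. A ternary term is a dual discriminator term for an algebra if it interprets as the dual discriminator function on that algebra. A variety $\mathcal{V}$ is a dual discriminator variety if it is generated as a variety by a subclass $\mathcal{K}\subseteq\mathcal{V}$ with a common dual discriminator term. Meet-irreducible congruences are the meet-irreducible elements of the congruence lattice of $\mathbf{A}$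 (the top congruence is not meet-irreducible). $\circ$ denotes relational composition. -}

module Defs where

open import Data.Fin.Base using (Fin)
open import Data.Nat.Base using (ℕ)
open import Data.Product.Base using (Σ-syntax; ∃-syntax; _×_; _,_)
open import Data.Sum.Base using (_⊎_)
open import Data.Vec.Base using (Vec; []; _∷_; lookup)
open import Data.Vec.Relation.Binary.Pointwise.Inductive using (Pointwise)
open import Function.Bundles using (_↔_)
open import Level using (Level; suc)
open import Relation.Binary.Construct.Closure.Transitive using (TransClosure)
open import Relation.Binary.Construct.Composition using () renaming (_;_ to _∘_)
open import Relation.Binary.Construct.Intersection using (_∩_)
open import Relation.Binary.Construct.Union using (_∪_)
open import Relation.Binary.Core using (Rel; _⇒_; _⇔_)
open import Relation.Binary.PropositionalEquality.Core using (_≡_; _≢_)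
open import Relation.Binary.Structures using (IsEquivalence)
open import Relation.Nullary.Negation.Core using (¬_)
open import Relation.Unary using (Pred; _∈_; _⊆_; _≐_)

private
  variable
    ℓ : Level
    k : ℕ

------------------------------------------------------------------------
-- Algebras.  The universe Set ℓ plays the role of the universe of sets:
-- operation symbols, carriers and relations are all ℓ-small.

record Signature (ℓ : Level) : Set (suc ℓ) where
  field
    Op    : Set ℓ
    arity : Op → ℕ

open Signature public

-- Carriers are not required to be inhabited.

record Algebra (S : Signature ℓ) : Set (suc ℓ) where
  field
    Carrier : Set ℓ
    ⟦_⟧     : (f : Op S) → Vec Carrier (arity S f) → Carrier

open Algebra public

Finite : {S : Signature ℓ} → Algebra S → Set ℓ
Finite A = ∃[ n ] (Fin n ↔ Carrier A)

------------------------------------------------------------------------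
-- Terms, identities and varieties

data Term (S : Signature ℓ) (X : Set) : Set ℓ where
  var : X → Term S X
  app : (f : Op S) → Vec (Term S X) (arity S f) → Term S X

module _ {S : Signature ℓ} (A : Algebra S) {X : Set} (ρ : X → Carrier A) where

  eval  : Term S X → Carrier A
  evals : ∀ {n} → Vec (Term S X) n → Vec (Carrier A) n

  eval (var x)    = ρ x
  eval (app f ts) = ⟦_⟧ A f (evals ts)

  evals []       = []
  evals (t ∷ ts) = eval t ∷ evals ts

Identity : Signature ℓ → Set ℓ
Identity S = Term S ℕ × Term S ℕ

infix 4 _⊨_

_⊨_ : {S : Signature ℓ} → Algebra S → Identity S → Set ℓ
A ⊨ (s , t) = ∀ (ρ : ℕ → Carrier A) → eval A ρ s ≡ eval A ρ t

Class : Signature ℓ → Set (suc (suc ℓ))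
Class {ℓ} S = Pred (Algebra S) (suc ℓ)

Models : {S : Signature ℓ} → Pred (Identity S) ℓ → Pred (Algebra S) ℓ
Models E A = ∀ e → e ∈ E → A ⊨ e

IsVariety : {S : Signature ℓ} → Class S → Set (suc ℓ)
IsVariety {ℓ} {S} V = Σ[ E ∈ Pred (Identity S) ℓ ] (V ≐ Models E)

IsVarietyGeneratedBy : {S : Signature ℓ} → Class S → Class S → Set (suc (suc ℓ))
IsVarietyGeneratedBy {S = S} V K =
  IsVariety V × K ⊆ V × (∀ (W : Class S) → IsVariety W → K ⊆ W → V ⊆ W)

------------------------------------------------------------------------
-- Dual discriminator varieties

-- Stated as a property of q because equality on A need not be decidable.

IsDualDiscriminator : {A : Set ℓ} → (A → A → A → A) → Set ℓ
IsDualDiscriminator q =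
  ∀ a b c → (a ≡ b → q a b c ≡ a) × (a ≢ b → q a b c ≡ c)

⟦_⟧₃ : {S : Signature ℓ} → Term S (Fin 3) → (A : Algebra S) →
       Carrier A → Carrier A → Carrier A → Carrier A
⟦ t ⟧₃ A a b c = eval A (lookup (a ∷ b ∷ c ∷ [])) t

IsDualDiscriminatorTermFor : {S : Signature ℓ} → Term S (Fin 3) → Algebra S → Set ℓ
IsDualDiscriminatorTermFor t A = IsDualDiscriminator (⟦ t ⟧₃ A)

IsDualDiscriminatorVariety : {S : Signature ℓ} → Class S → Set (suc (suc ℓ))
IsDualDiscriminatorVariety {S = S} V =
  Σ[ K ∈ Class S ] Σ[ t ∈ Term S (Fin 3) ]
    IsVarietyGeneratedBy V K × (∀ B → B ∈ K → IsDualDiscriminatorTermFor t B)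

------------------------------------------------------------------------
-- Congruences.  Inclusion and equality of congruences are the relations
-- _⇒_ and _⇔_ (mutual inclusion) between the underlying relations.

record Congruence {S : Signature ℓ} (A : Algebra S) : Set (suc ℓ) where
  field
    rel           : Rel (Carrier A) ℓ
    isEquivalence : IsEquivalence rel
    compatible    : ∀ f {xs ys} → Pointwise rel xs ys → rel (⟦_⟧ A f xs) (⟦_⟧ A f ys)

open Congruence public

module _ {S : Signature ℓ} {A : Algebra S} where

  infixr 6 _∨_

  _∨_ : Congruence A → Congruence A → Rel (Carrier A) ℓ
  θ ∨ δ = TransClosure (rel θ ∪ rel δ)

  ⋂ : (Fin k → Congruence A) → Rel (Carrier A) ℓ
  ⋂ θ x y = ∀ j → rel (θ j) x y

  MeetIrreducible : Pred (Congruence A) (suc ℓ)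
  MeetIrreducible θ =
    ¬ (∀ x y → rel θ x y) ×
    (∀ (α β : Congruence A) → rel θ ⇔ (rel α ∩ rel β) → rel θ ⇔ rel α ⊎ rel θ ⇔ rel β)

  MeetIrreducibleAbove : (Fin k → Congruence A) → Pred (Congruence A) (suc ℓ)
  MeetIrreducibleAbove θ σ = MeetIrreducible σ × ⋂ θ ⇒ rel σ

  IsCRTuple : (Fin k → Congruence A) → Set ℓ
  IsCRTuple {k} θ =
    ∀ (a : Fin k → Carrier A) →
    (∀ i j → (θ i ∨ θ j) (a i) (a j)) →
    ∃[ x ] (∀ i → rel (θ i) x (a i))

  PairCondition : (Fin k → Congruence A) → Congruence A → Congruence A → Set (suc ℓ)
  PairCondition θ λ′ μ =
      (rel λ′ ∘ rel μ) ⇔ (rel μ ∘ rel λ′)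
    ⊎ (Σ[ σ ∈ Congruence A ]
         σ ∈ MeetIrreducibleAbove θ
         × ¬ (rel σ ⇔ rel λ′) × ¬ (rel σ ⇔ rel μ)
         × rel σ ⇒ (rel λ′ ∘ rel μ))
    ⊎ (∃[ j ] (rel (θ j) ⇒ (rel λ′ ∩ rel μ)))

module Submission where

-- A dual discriminator term q is a majority term, and the identities that
-- q satisfies on the generating class hold throughout the variety.  They
-- imply (meetIrreducible⇒discriminates) that q acts as the dual
-- discriminator on the quotient of A by a meet-irreducible congruence.
-- Three consequences carry the proof.  Meet-irreducible congruences are
-- meet-prime, so every member of Σ lies above some θ j (meet-prime).  A
-- system of congruences that is solvable in pairs is solvable
-- (chineseRemainder).  And for meet-irreducible λ and μ, a λ-class either
-- meets all μ-classes or lies in one of them; hence, if (u , v) is not in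
-- λ ∘ μ, the elements reached from u through λ ∘ μ form exactly the
-- μ-class of u, and dually for v (class-meets and
-- unrelated⇒class-inclusion).
--
-- From the Chinese Remainder property to the condition on pairs: suppose
-- that the condition fails for λ and μ.  Then some (u₀ , v₀) is not in
-- λ ∘ μ, and no other σ in Σ is contained in λ ∘ μ.  For two such σ and τ
-- the obvious obstacle to pulling u₀ and v₀ together, without leaving the
-- λ-class of u₀ and the μ-class of v₀, would force σ into λ ∘ μ
-- (product-above).  So there is a pair (u , v) outside λ ∘ μ which all
-- those σ relate (common-pair).  Put a j = u if θ j is below λ, and
-- a j = v otherwise.  Since congruences are meets of meet-irreducible
-- ones (separate), this is an admissible tuple; but a solution would put
-- (u , v) into λ ∘ μ (common-pair⇒¬crTuple).
--
-- Conversely, given an admissible tuple a, it suffices to solve the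
-- constraints x σ (a j) for σ meet-irreducible above θ j, and hence to
-- solve them in pairs.  Among the unsolvable pairs of constraints choose
-- one whose moduli λ and μ have a minimal product λ ∘ μ.  Permuting moduli
-- have a full product unless they are equal, and a common θ l below both
-- provides the solution a l.  If another σ in Σ is contained in λ ∘ μ, then
-- so are λ ∘ σ and σ ∘ μ.  A constraint with modulus σ that could not be
-- solved together with that of λ would by minimality make λ ∘ σ and λ ∘ μ
-- equal, which distinct-products excludes; the same holds for μ.  The two
-- solutions put the given values into λ ∘ σ ∘ μ, which is contained in
-- λ ∘ μ.

open import Defs
open import Axiom.DoubleNegationElimination using (em⇒dne)
open import Axiom.ExcludedMiddle using (ExcludedMiddle)
open import Data.Empty using (⊥; ⊥-elim)
open import Data.Fin.Base as Fin using (Fin; toℕ)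
open import Data.List.Base as List using (List; []; _∷_; cartesianProduct)
open import Data.List.Membership.Propositional using () renaming (_∈_ to _∈ₗ_)
open import Data.List.Membership.Propositional.Properties
  using (∈-allFin; ∈-cartesianProduct⁺; ∈-map⁺)
open import Data.List.Relation.Unary.All as All using (All; []; _∷_)
open import Data.List.Relation.Unary.Any using (here; there)
open import Data.Maybe.Base using (Maybe; just; nothing; maybe)
open import Data.Nat.Base using (ℕ; NonZero; >-nonZero⁻¹)
open import Data.Product.Base using (Σ-syntax; ∃-syntax; ∃₂; _×_; _,_; proj₁; proj₂; swap)
import Data.Sum.Base as Sum
open import Data.Sum.Base using (_⊎_; inj₁; inj₂)
open import Data.Unit.Base using (⊤; tt)
open import Data.Vec.Base using (Vec; []; _∷_; lookup; map; tabulate)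
open import Data.Vec.Properties using (tabulate-cong; tabulate∘lookup)
open import Data.Vec.Relation.Binary.Pointwise.Inductive as Pointwise using (Pointwise; []; _∷_)
open import Function.Base using (_∘_; const; id; case_of_)
open import Function.Bundles using (_⇔_; mk⇔; Inverse)
open import Level using (Level; Lift; lift; lower; suc)
open import Relation.Binary.Bundles using (Setoid)
open import Relation.Binary.Construct.Closure.Transitive as Plus using (TransClosure; [_]; _∷_; _++_)
open import Relation.Binary.Construct.Composition using () renaming (_;_ to _∘ᵣ_)
open import Relation.Binary.Construct.Intersection using (_∩_)
open import Relation.Binary.Construct.Union using (_∪_)
open import Relation.Binary.Core using (Rel; _⇒_; _=[_]⇒_) renaming (_⇔_ to _≑_)
open import Relation.Binary.PropositionalEquality
  using (_≡_; _≢_; refl; sym; trans; cong; cong₂; module ≡-Reasoning)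
import Relation.Binary.Reasoning.Setoid as SetoidReasoning
open import Relation.Binary.Structures using (IsEquivalence)
open import Relation.Nullary.Decidable using (yes; no; map′)
open import Relation.Nullary.Negation using (¬_; contradiction)
open import Relation.Unary using (Pred; _∈_)

private
  variable
    ℓ : Level
    S : Signature ℓ
    X Y : Set
    k n : ℕ

-- Evaluation of terms

module _ (τ : X → Term S Y) where

  substitute  : Term S X → Term S Y
  substitutes : Vec (Term S X) n → Vec (Term S Y) n

  substitute (var x)    = τ x
  substitute (app f ts) = app f (substitutes ts)

  substitutes []       = []
  substitutes (t ∷ ts) = substitute t ∷ substitutes ts

-- The hypothesis is pointwise, so no function extensionality is needed.
module _ (A : Algebra S) {τ : X → Term S Y} {ρ : Y → Carrier A} {ρ′ : X → Carrier A}
         (ρ∘τ≗ρ′ : ∀ x → eval A ρ (τ x) ≡ ρ′ x) where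

  eval-substitute   : ∀ t → eval A ρ (substitute τ t) ≡ eval A ρ′ t
  evals-substitutes : ∀ (ts : Vec _ n) → evals A ρ (substitutes τ ts) ≡ evals A ρ′ ts

  eval-substitute (var x)    = ρ∘τ≗ρ′ x
  eval-substitute (app f ts) = cong (⟦_⟧ A f) (evals-substitutes ts)

  evals-substitutes []       = refl
  evals-substitutes (t ∷ ts) = cong₂ _∷_ (eval-substitute t) (evals-substitutes ts)

module _ (A : Algebra S) {ρ : X → Carrier A} where

  evals-tabulate : (g : Fin n → Term S X) →
                   evals A ρ (tabulate g) ≡ tabulate (eval A ρ ∘ g)
  evals-tabulate {n = ℕ.zero}  g = refl
  evals-tabulate {n = ℕ.suc n} g = cong (eval A ρ (g Fin.zero) ∷_) (evals-tabulate (g ∘ Fin.suc))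

  evals-map : {g : Term S X → Term S X} {h : Carrier A → Carrier A} →
              (∀ t → eval A ρ (g t) ≡ h (eval A ρ t)) →
              (ts : Vec _ n) → evals A ρ (map g ts) ≡ map h (evals A ρ ts)
  evals-map e []       = refl
  evals-map e (t ∷ ts) = cong₂ _∷_ (e t) (evals-map e ts)

module _ {A : Algebra S} (θ : Congruence A) {ρ ρ′ : X → Carrier A}
         (ρ∼ρ′ : ∀ x → rel θ (ρ x) (ρ′ x)) where

  eval-cong  : ∀ t → rel θ (eval A ρ t) (eval A ρ′ t)
  evals-cong : ∀ (ts : Vec _ n) → Pointwise (rel θ) (evals A ρ ts) (evals A ρ′ ts)

  eval-cong (var x)    = ρ∼ρ′ x
  eval-cong (app f ts) = compatible θ f (evals-cong ts)

  evals-cong []       = []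
  evals-cong (t ∷ ts) = eval-cong t ∷ evals-cong ts

⟦⟧₃-cong : {A : Algebra S} (t : Term S (Fin 3)) (θ : Congruence A) →
           ∀ {a a′ b b′ c c′} → rel θ a a′ → rel θ b b′ → rel θ c c′ →
           rel θ (⟦ t ⟧₃ A a b c) (⟦ t ⟧₃ A a′ b′ c′)
⟦⟧₃-cong t θ aa′ bb′ cc′ =
  eval-cong θ (Pointwise.lookup {_∼_ = rel θ} (aa′ ∷ bb′ ∷ cc′ ∷ [])) t

-- Expansion by a term operation

-- The signature S with one extra ternary symbol, standing for the term
-- operation of a fixed term t.  Identities in the dual discriminator and
-- the basic operations are written over it, so that evaluating them in
-- expand t A computes.
_⁺ : Signature ℓ → Signature ℓ
S ⁺ = record { Op = Op S ⊎ ⊤ ; arity = Sum.[ arity S , const 3 ] }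

module _ (t : Term S (Fin 3)) where

  -- A with the extra symbol interpreted as the term operation of t.
  expand : Algebra S → Algebra (S ⁺)
  Carrier (expand A)                       = Carrier A
  ⟦_⟧ (expand A) (inj₁ f)                  = ⟦_⟧ A f
  ⟦_⟧ (expand A) (inj₂ _) (a ∷ b ∷ c ∷ []) = ⟦ t ⟧₃ A a b c

  -- Unfolding the extra symbol to the term t.
  flatten  : Term (S ⁺) X → Term S X
  flattens : Vec (Term (S ⁺) X) n → Vec (Term S X) n

  flatten (var x)                         = var x
  flatten (app (inj₁ f) ts)               = app f (flattens ts)
  flatten (app (inj₂ _) (r ∷ s ∷ u ∷ [])) =
    substitute (lookup (flatten r ∷ flatten s ∷ flatten u ∷ [])) t

  flattens []       = []
  flattens (t ∷ ts) = flatten t ∷ flattens ts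

  module _ (A : Algebra S) {ρ : X → Carrier A} where

    eval-flatten   : ∀ s → eval A ρ (flatten s) ≡ eval (expand A) ρ s
    evals-flattens : ∀ (ss : Vec _ n) → evals A ρ (flattens ss) ≡ evals (expand A) ρ ss

    eval-flatten (var x)           = refl
    eval-flatten (app (inj₁ f) ts) = cong (⟦_⟧ A f) (evals-flattens ts)
    eval-flatten (app (inj₂ _) (r ∷ s ∷ u ∷ [])) = eval-substitute A pointwise t
      where
      pointwise : ∀ i → eval A ρ (lookup (flatten r ∷ flatten s ∷ flatten u ∷ []) i) ≡
                        lookup (evals (expand A) ρ (r ∷ s ∷ u ∷ [])) i
      pointwise Fin.zero                     = eval-flatten r
      pointwise (Fin.suc Fin.zero)           = eval-flatten s
      pointwise (Fin.suc (Fin.suc Fin.zero)) = eval-flatten u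

    evals-flattens []       = refl
    evals-flattens (s ∷ ss) = cong₂ _∷_ (eval-flatten s) (evals-flattens ss)

-- An identity over the expanded signature that holds in the generating
-- class holds in the whole variety: the models of its unfolding form a
-- variety that contains the class.
identity-transfer :
  {S : Signature ℓ} {V K : Class S} → IsVarietyGeneratedBy V K →
  (t : Term S (Fin 3)) (e : Identity (S ⁺)) →
  (∀ B → B ∈ K → expand t B ⊨ e) → ∀ A → A ∈ V → expand t A ⊨ e
identity-transfer {ℓ} {S} {K = K} (_ , _ , least) t (s , u) K⊨e A A∈V ρ = begin
  eval (expand t A) ρ s   ≡⟨ eval-flatten t A s ⟨
  eval A ρ (flatten t s)  ≡⟨ lower A∈W (flatten t s , flatten t u) refl ρ ⟩
  eval A ρ (flatten t u)  ≡⟨ eval-flatten t A u ⟩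
  eval (expand t A) ρ u   ∎
  where
  open ≡-Reasoning
  E : Pred (Identity S) ℓ
  E = _≡ (flatten t s , flatten t u)
  W : Class S
  W A = Lift (suc ℓ) (Models E A)
  W-variety : IsVariety W
  W-variety = E , lower , lift
  K⊆W : ∀ {B} → B ∈ K → B ∈ W
  K⊆W {B} B∈K = lift λ { _ refl ρ →
    trans (eval-flatten t B s) (trans (K⊨e B B∈K ρ) (sym (eval-flatten t B u))) }
  A∈W : A ∈ W
  A∈W = least W W-variety (λ {B} → K⊆W {B}) {A} A∈V

-- Identities of the dual discriminator

-- Identities of the dual discriminator that, unlike its definition, pass
-- to the generated variety.  In each of them, apart from the majority
-- laws, both sides can be compared by distinguishing a = b from a ≠ b.
record DualDiscriminatorLaws {S : Signature ℓ} (A : Algebra S)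
       (q : Carrier A → Carrier A → Carrier A → Carrier A) : Set ℓ where
  field
    -- The three majority laws.
    aac : ∀ a c → q a a c ≡ a
    aba : ∀ a b → q a b a ≡ a
    abb : ∀ a b → q a b b ≡ b
    idem : ∀ a b c → q a b (q a b c) ≡ q a b c
    -- The next four laws serve the symmetry of orthogonality.
    distribˡ : ∀ a b c d → q a b (q c d a) ≡ q (q a b c) (q a b d) a
    distribʳ : ∀ a b c d → q a b (q c d b) ≡ q (q a b c) (q a b d) b
    recoverˡ : ∀ a b c d → q (q c d a) (q c d b) (q a b (q c d a)) ≡ q c d a
    recoverʳ : ∀ a b c d → q (q c d a) (q c d b) (q a b (q c d b)) ≡ q c d b
    -- By this law the kernel of q a b is compatible with the operations of A.
    absorb : ∀ f a b us → q a b (⟦_⟧ A f (map (q a b) us)) ≡ q a b (⟦_⟧ A f us)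

module _ (em : ExcludedMiddle ℓ) {S : Signature ℓ} (A : Algebra S)
         {q : Carrier A → Carrier A → Carrier A → Carrier A} (dd : IsDualDiscriminator q) where

  private
    aac : ∀ a c → q a a c ≡ a
    aac a c = proj₁ (dd a a c) refl
    diff : ∀ {a b} → a ≢ b → ∀ c → q a b c ≡ c
    diff a≢b c = proj₂ (dd _ _ c) a≢b
    aba : ∀ a b → q a b a ≡ a
    aba a b with em {a ≡ b}
    ... | yes refl = aac a a
    ... | no a≢b   = diff a≢b a
    abb : ∀ a b → q a b b ≡ b
    abb a b with em {a ≡ b}
    ... | yes refl = aac a a
    ... | no a≢b   = diff a≢b b

    idem : ∀ a b c → q a b (q a b c) ≡ q a b c
    idem a b c with em {a ≡ b}
    ... | yes refl = trans (aac a _) (sym (aac a c))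
    ... | no a≢b   = diff a≢b _

    distribˡ : ∀ a b c d → q a b (q c d a) ≡ q (q a b c) (q a b d) a
    distribˡ a b c d with em {a ≡ b}
    ... | yes refl rewrite aac a c | aac a d = trans (aac a _) (sym (aac a a))
    ... | no a≢b rewrite diff a≢b c | diff a≢b d = diff a≢b _

    distribʳ : ∀ a b c d → q a b (q c d b) ≡ q (q a b c) (q a b d) b
    distribʳ a b c d with em {a ≡ b}
    ... | yes refl = distribˡ a a c d
    ... | no a≢b rewrite diff a≢b c | diff a≢b d = diff a≢b _

    recoverˡ : ∀ a b c d → q (q c d a) (q c d b) (q a b (q c d a)) ≡ q c d a
    recoverˡ a b c d with em {a ≡ b}
    ... | yes refl = aac _ _
    ... | no a≢b rewrite diff a≢b (q c d a) = aba _ _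

    recoverʳ : ∀ a b c d → q (q c d a) (q c d b) (q a b (q c d b)) ≡ q c d b
    recoverʳ a b c d with em {a ≡ b}
    ... | yes refl = aac _ _
    ... | no a≢b rewrite diff a≢b (q c d b) = abb _ _

    map-diff : ∀ {a b} → a ≢ b → (us : Vec (Carrier A) n) → map (q a b) us ≡ us
    map-diff a≢b []       = refl
    map-diff a≢b (u ∷ us) = cong₂ _∷_ (diff a≢b u) (map-diff a≢b us)

    absorb : ∀ f a b us → q a b (⟦_⟧ A f (map (q a b) us)) ≡ q a b (⟦_⟧ A f us)
    absorb f a b us with em {a ≡ b}
    ... | yes refl = trans (aac a _) (sym (aac a _))
    ... | no a≢b   = cong (λ vs → q a b (⟦_⟧ A f vs)) (map-diff a≢b us)

  dualDiscriminator⇒laws : DualDiscriminatorLaws A q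
  dualDiscriminator⇒laws = record
    { aac = aac ; aba = aba ; abb = abb ; idem = idem ; distribˡ = distribˡ ; distribʳ = distribʳ
    ; recoverˡ = recoverˡ ; recoverʳ = recoverʳ ; absorb = absorb }

module _ (em : ExcludedMiddle ℓ) {S : Signature ℓ} {V K : Class S} (V=⟨K⟩ : IsVarietyGeneratedBy V K)
         (t : Term S (Fin 3)) (t-dd : ∀ B → B ∈ K → IsDualDiscriminatorTermFor t B)
         (A : Algebra S) (A∈V : A ∈ V) where

  private
    x₀ x₁ x₂ x₃ : Term (S ⁺) ℕ
    x₀ = var 0
    x₁ = var 1
    x₂ = var 2
    x₃ = var 3

    Q : Term (S ⁺) ℕ → Term (S ⁺) ℕ → Term (S ⁺) ℕ → Term (S ⁺) ℕ
    Q r s u = app (inj₂ tt) (r ∷ s ∷ u ∷ [])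

    -- The n variables from the third on, as arguments of an operation; the
    -- first two variables are the parameters a and b of the law absorb.
    xs₊₂ : ∀ n → Vec (Term (S ⁺) ℕ) n
    xs₊₂ n = tabulate (λ i → var (ℕ.suc (ℕ.suc (toℕ i))))

    -- Total lookup; the default value d is never relevant to the terms used.
    nth : Carrier A → Vec (Carrier A) n → ℕ → Carrier A
    nth d []       _         = d
    nth d (u ∷ us) ℕ.zero    = u
    nth d (u ∷ us) (ℕ.suc i) = nth d us i

    nth-toℕ : ∀ d (us : Vec (Carrier A) n) i → nth d us (toℕ i) ≡ lookup us i
    nth-toℕ d (u ∷ us) Fin.zero    = refl
    nth-toℕ d (u ∷ us) (Fin.suc i) = nth-toℕ d us i

    assign : Carrier A → Carrier A → Vec (Carrier A) n → ℕ → Carrier A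
    assign a b us = nth a (a ∷ b ∷ us)

    evals-xs₊₂ : ∀ a b (us : Vec (Carrier A) n) →
                 evals (expand t A) (assign a b us) (xs₊₂ n) ≡ us
    evals-xs₊₂ a b us = begin
      evals (expand t A) (assign a b us) (xs₊₂ _)  ≡⟨ evals-tabulate (expand t A) _ ⟩
      tabulate (nth a us ∘ toℕ)                    ≡⟨ tabulate-cong (nth-toℕ a us) ⟩
      tabulate (lookup us)                         ≡⟨ tabulate∘lookup us ⟩
      us                                           ∎
      where open ≡-Reasoning

    transfer : ∀ s u → (∀ B → DualDiscriminatorLaws B (⟦ t ⟧₃ B) → expand t B ⊨ (s , u)) →
               expand t A ⊨ (s , u)
    transfer s u h = identity-transfer V=⟨K⟩ t (s , u)
      (λ B B∈K → h B (dualDiscriminator⇒laws em B (t-dd B B∈K))) A A∈V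

    absorbing-evals : ∀ B ρ n → evals (expand t B) ρ (map (Q x₀ x₁) (xs₊₂ n)) ≡
                      map (⟦ t ⟧₃ B (ρ 0) (ρ 1)) (evals (expand t B) ρ (xs₊₂ n))
    absorbing-evals B ρ n = evals-map (expand t B) (λ _ → refl) (xs₊₂ n)

    absorb-V : ∀ f a b us →
               ⟦ t ⟧₃ A a b (⟦_⟧ A f (map (⟦ t ⟧₃ A a b) us)) ≡ ⟦ t ⟧₃ A a b (⟦_⟧ A f us)
    absorb-V f a b us = begin
      q (⟦_⟧ A f (map q us))
        ≡⟨ cong (λ vs → q (⟦_⟧ A f (map q vs))) (evals-xs₊₂ a b us) ⟨
      q (⟦_⟧ A f (map q (evs (xs₊₂ _))))
        ≡⟨ cong (q ∘ ⟦_⟧ A f) (absorbing-evals A ρ _) ⟨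
      q (⟦_⟧ A f (evs (map (Q x₀ x₁) (xs₊₂ _))))
        ≡⟨ transfer (Q x₀ x₁ (app (inj₁ f) (map (Q x₀ x₁) (xs₊₂ _))))
                    (Q x₀ x₁ (app (inj₁ f) (xs₊₂ _)))
             (λ B laws ρ → trans
               (cong (⟦ t ⟧₃ B (ρ 0) (ρ 1) ∘ ⟦_⟧ B f) (absorbing-evals B ρ _))
               (DualDiscriminatorLaws.absorb laws f (ρ 0) (ρ 1) _))
             ρ ⟩
      q (⟦_⟧ A f (evs (xs₊₂ _)))
        ≡⟨ cong (q ∘ ⟦_⟧ A f) (evals-xs₊₂ a b us) ⟩
      q (⟦_⟧ A f us)  ∎
      where
      open ≡-Reasoning
      q = ⟦ t ⟧₃ A a b
      ρ = assign a b us
      evs : ∀ {n} → Vec (Term (S ⁺) ℕ) n → Vec (Carrier A) n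
      evs = evals (expand t A) ρ

  open DualDiscriminatorLaws

  variety-laws : DualDiscriminatorLaws A (⟦ t ⟧₃ A)
  aac variety-laws a c =
    transfer (Q x₀ x₀ x₁) x₀ (λ _ laws ρ → aac laws (ρ 0) (ρ 1)) (assign a c [])
  aba variety-laws a b =
    transfer (Q x₀ x₁ x₀) x₀ (λ _ laws ρ → aba laws (ρ 0) (ρ 1)) (assign a b [])
  abb variety-laws a b =
    transfer (Q x₀ x₁ x₁) x₁ (λ _ laws ρ → abb laws (ρ 0) (ρ 1)) (assign a b [])
  idem variety-laws a b c =
    transfer (Q x₀ x₁ (Q x₀ x₁ x₂)) (Q x₀ x₁ x₂)
      (λ _ laws ρ → idem laws (ρ 0) (ρ 1) (ρ 2)) (assign a b (c ∷ []))
  distribˡ variety-laws a b c d =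
    transfer (Q x₀ x₁ (Q x₂ x₃ x₀)) (Q (Q x₀ x₁ x₂) (Q x₀ x₁ x₃) x₀)
      (λ _ laws ρ → distribˡ laws (ρ 0) (ρ 1) (ρ 2) (ρ 3)) (assign a b (c ∷ d ∷ []))
  distribʳ variety-laws a b c d =
    transfer (Q x₀ x₁ (Q x₂ x₃ x₁)) (Q (Q x₀ x₁ x₂) (Q x₀ x₁ x₃) x₁)
      (λ _ laws ρ → distribʳ laws (ρ 0) (ρ 1) (ρ 2) (ρ 3)) (assign a b (c ∷ d ∷ []))
  recoverˡ variety-laws a b c d =
    transfer (Q (Q x₂ x₃ x₀) (Q x₂ x₃ x₁) (Q x₀ x₁ (Q x₂ x₃ x₀))) (Q x₂ x₃ x₀)
      (λ _ laws ρ → recoverˡ laws (ρ 0) (ρ 1) (ρ 2) (ρ 3)) (assign a b (c ∷ d ∷ []))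
  recoverʳ variety-laws a b c d =
    transfer (Q (Q x₂ x₃ x₀) (Q x₂ x₃ x₁) (Q x₀ x₁ (Q x₂ x₃ x₁))) (Q x₂ x₃ x₁)
      (λ _ laws ρ → recoverʳ laws (ρ 0) (ρ 1) (ρ 2) (ρ 3)) (assign a b (c ∷ d ∷ []))
  absorb variety-laws = absorb-V

-- Congruences of finite algebras

lower-excludedMiddle : ExcludedMiddle (suc ℓ) → ExcludedMiddle ℓ
lower-excludedMiddle em⁺ = map′ lower lift em⁺

module _ {S : Signature ℓ} {A : Algebra S} where

  module _ (θ : Congruence A) where
    open IsEquivalence (isEquivalence θ) public using ()
      renaming (refl to rel-refl; sym to rel-sym; trans to rel-trans; reflexive to rel-reflexive)

  setoid : Congruence A → Setoid ℓ ℓ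
  setoid θ = record { isEquivalence = isEquivalence θ }

  ∘-converse : (λ′ μ : Congruence A) → ∀ {x y} →
               (rel λ′ ∘ᵣ rel μ) x y → (rel μ ∘ᵣ rel λ′) y x
  ∘-converse λ′ μ (z , xλz , zμy) = z , rel-sym μ zμy , rel-sym λ′ xλz

  -- The join of two congruences, as a congruence.  For compatibility with
  -- an n-ary operation, its arguments are changed one coordinate at a time.
  joinCongruence : Congruence A → Congruence A → Congruence A
  joinCongruence θ δ = record
    { rel           = θ ∨ δ
    ; isEquivalence = record
      { refl  = λ {x} → [ inj₁ (rel-refl θ {x}) ]
      ; sym   = Plus.symmetric _ (Sum.map (rel-sym θ) (rel-sym δ))
      ; trans = _++_
      }
    ; compatible    = λ f xs∼ys → mapPlus (step f) (coordinatewise xs∼ys)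
    }
    where
    Step : Rel (Vec (Carrier A) n) _
    Step = Pointwise (rel θ) ∪ Pointwise (rel δ)

    mapPlus : ∀ {a b r s} {B : Set a} {C : Set b} {R : Rel B r} {T : Rel C s} {g : B → C} →
              R =[ g ]⇒ T → TransClosure R =[ g ]⇒ TransClosure T
    mapPlus h [ r ]    = [ h r ]
    mapPlus h (r ∷ rs) = h r ∷ mapPlus h rs

    step : ∀ f → Step =[ ⟦_⟧ A f ]⇒ (rel θ ∪ rel δ)
    step f = Sum.map (compatible θ f) (compatible δ f)

    onHead : ∀ (xs : Vec _ n) → (rel θ ∪ rel δ) =[ _∷ xs ]⇒ Step
    onHead xs (inj₁ p) = inj₁ (p ∷ Pointwise.refl (rel-refl θ))
    onHead xs (inj₂ p) = inj₂ (p ∷ Pointwise.refl (rel-refl δ))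

    onTail : ∀ y → Step {n} =[ y ∷_ ]⇒ Step
    onTail y (inj₁ p) = inj₁ (rel-refl θ ∷ p)
    onTail y (inj₂ p) = inj₂ (rel-refl δ ∷ p)

    coordinatewise : ∀ {xs ys : Vec _ n} → Pointwise (θ ∨ δ) xs ys → TransClosure Step xs ys
    coordinatewise []       = [ inj₁ [] ]
    coordinatewise {xs = _ ∷ xs} {y ∷ _} (p ∷ ps) =
      mapPlus (onHead xs) p ++ mapPlus (onTail y) (coordinatewise ps)

  join-least : (θ δ σ : Congruence A) → rel θ ⇒ rel σ → rel δ ⇒ rel σ → θ ∨ δ ⇒ rel σ
  join-least θ δ σ θ⊆σ δ⊆σ [ p ]    = Sum.[ θ⊆σ , δ⊆σ ] p
  join-least θ δ σ θ⊆σ δ⊆σ (p ∷ ps) =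
    rel-trans σ (Sum.[ θ⊆σ , δ⊆σ ] p) (join-least θ δ σ θ⊆σ δ⊆σ ps)

elements : {S : Signature ℓ} (A : Algebra S) → Finite A →
           Σ[ xs ∈ List (Carrier A) ] (∀ x → x ∈ₗ xs)
elements A (n , Fin↔A) = List.map to (List.allFin n) , complete
  where
  open Inverse Fin↔A
  complete : ∀ x → x ∈ₗ List.map to (List.allFin n)
  complete x rewrite sym (strictlyInverseˡ x) = ∈-map⁺ to (∈-allFin (from x))

module _ (em⁺ : ExcludedMiddle (suc ℓ)) where

  private
    em : ExcludedMiddle ℓ
    em = lower-excludedMiddle em⁺

  -- In an inhabited family of subsets of E, some member is minimal for
  -- inclusion as far as the points in the list es are concerned.  Going through es, it suffices to pass to a
  -- smaller member that omits the next point whenever there is one.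
  minimal : {E : Set ℓ} (es : List E) {I : Set (suc ℓ)} (P : I → Pred E ℓ) → I →
            Σ[ i ∈ I ] (∀ j → (∀ e → P j e → P i e) → ∀ {e} → e ∈ₗ es → P i e → P j e)
  minimal []       P i₀ = i₀ , λ _ _ ()
  minimal (e ∷ es) {I} P i₀ with minimal es P i₀
  ... | i , i-min with em⁺ {Σ[ j ∈ I ] ((∀ e → P j e → P i e) × ¬ P j e)}
  ...   | yes (j , Pj⊆Pi , ¬Pje) = j , λ where
            k Pk⊆Pj (here refl) Pje  → contradiction Pje ¬Pje
            k Pk⊆Pj (there e∈)  Pje′ → i-min k (λ e → Pj⊆Pi e ∘ Pk⊆Pj e) e∈ (Pj⊆Pi _ Pje′)
  ...   | no none = i , λ where
            j Pj⊆Pi (here refl) Pie → em⇒dne em (λ ¬Pje → none (j , Pj⊆Pi , ¬Pje))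
            j Pj⊆Pi (there e∈)  Pie → i-min j Pj⊆Pi e∈ Pie

  module _ {S : Signature ℓ} (A : Algebra S) (fin : Finite A) where

    private
      L  = proj₁ (elements A fin)
      ∈L = proj₂ (elements A fin)

    -- A pair outside α is avoided by some meet-irreducible congruence above
    -- α, namely by any congruence that is maximal among those above α that
    -- avoid the pair.
    separate : (α : Congruence A) → ∀ {x y} → ¬ rel α x y →
               Σ[ σ ∈ Congruence A ] (σ ∈ MeetIrreducible × rel α ⇒ rel σ × ¬ rel σ x y)
    separate α {x} {y} ¬αxy = σ , (σ-proper , σ-irreducible) , α⊆σ , ¬σxy
      where
      Separating : Set (suc ℓ)
      Separating = Σ[ β ∈ Congruence A ] (rel α ⇒ rel β × ¬ rel β x y)

      -- Minimal complements are maximal congruences.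
      Outside : Separating → Pred (Carrier A × Carrier A) ℓ
      Outside (β , _) (u , v) = ¬ rel β u v

      best : _
      best = minimal (cartesianProduct L L) Outside (α , id , ¬αxy)

      σ : Congruence A
      σ = proj₁ (proj₁ best)
      α⊆σ : rel α ⇒ rel σ
      α⊆σ = proj₁ (proj₂ (proj₁ best))
      ¬σxy : ¬ rel σ x y
      ¬σxy = proj₂ (proj₂ (proj₁ best))

      σ-proper : ¬ (∀ u v → rel σ u v)
      σ-proper full = ¬σxy (full x y)

      σ-maximal : (β : Congruence A) → rel σ ⇒ rel β → ¬ rel β x y → rel σ ≑ rel β
      σ-maximal β σ⊆β ¬βxy = σ⊆β , λ {u} {v} βuv → em⇒dne em λ ¬σuv →
        proj₂ best (β , σ⊆β ∘ α⊆σ , ¬βxy) (λ _ ¬β → ¬β ∘ σ⊆β)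
          (∈-cartesianProduct⁺ (∈L u) (∈L v)) ¬σuv βuv

      σ-irreducible : ∀ β γ → rel σ ≑ (rel β ∩ rel γ) → rel σ ≑ rel β ⊎ rel σ ≑ rel γ
      σ-irreducible β γ (σ⊆ , ⊆σ) with em {rel β x y}
      ... | no ¬βxy  = inj₁ (σ-maximal β (proj₁ ∘ σ⊆) ¬βxy)
      ... | yes βxy = inj₂ (σ-maximal γ (proj₂ ∘ σ⊆) λ γxy → ¬σxy (⊆σ (βxy , γxy)))

-- Congruences in the presence of the dual discriminator laws

module DualDiscriminator (em⁺ : ExcludedMiddle (suc ℓ)) {S : Signature ℓ} (A : Algebra S)
  (q : Carrier A → Carrier A → Carrier A → Carrier A) (laws : DualDiscriminatorLaws A q)
  (q-cong : ∀ (θ : Congruence A) {a a′ b b′ c c′} → rel θ a a′ → rel θ b b′ → rel θ c c′ →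
            rel θ (q a b c) (q a′ b′ c′)) where

  open DualDiscriminatorLaws laws

  private
    em : ExcludedMiddle ℓ
    em = lower-excludedMiddle em⁺

    dne : {P : Set ℓ} → ¬ ¬ P → P
    dne = em⇒dne em

    variable
      x y : Carrier A
      λ′ μ σ τ : Congruence A

  -- Quotients by meet-irreducible congruences

  -- The law q x x z = x, read modulo θ.
  q-agree : (θ : Congruence A) → rel θ x y → ∀ z → rel θ (q x y z) x
  q-agree θ xθy z = rel-trans θ (q-cong θ (rel-refl θ) (rel-sym θ xθy) (rel-refl θ))
    (rel-reflexive θ (aac _ z))

  q-fix : (θ : Congruence A) → rel θ x y → ∀ z → rel θ x (q x y z)
  q-fix θ xθy z = rel-sym θ (q-agree θ xθy z)

  -- The quotient by σ is nontrivial and q acts on it as the dual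
  -- discriminator.  The case of related arguments, being a consequence of
  -- the majority laws, is left out.
  record Discriminates (σ : Congruence A) : Set ℓ where
    field
      proper  : ¬ (∀ x y → rel σ x y)
      discern : ∀ {x y} → ¬ rel σ x y → ∀ z → rel σ (q x y z) z

  open Discriminates

  -- Call (a , b) and (c , d) orthogonal modulo θ if q a b c and q a b d are
  -- θ-related.  In a product of algebras on which q is the dual
  -- discriminator, and for equality as θ, this says that a = b or c = d in
  -- each coordinate; whence the symmetry.
  orthogonal-sym : (θ : Congruence A) → ∀ {a b c d} →
                   rel θ (q a b c) (q a b d) → rel θ (q c d a) (q c d b)
  orthogonal-sym θ {a} {b} {c} {d} abc∼abd = begin
    ca                    ≈⟨ rel-reflexive θ (recoverˡ a b c d) ⟨
    q ca cb (q a b ca)    ≈⟨ q-cong θ (rel-refl θ) (rel-refl θ) (collapse (distribˡ a b c d)) ⟩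
    q ca cb (q a b c)     ≈⟨ q-cong θ (rel-refl θ) (rel-refl θ) (collapse (distribʳ a b c d)) ⟨
    q ca cb (q a b cb)    ≈⟨ rel-reflexive θ (recoverʳ a b c d) ⟩
    cb                    ∎
    where
    open SetoidReasoning (setoid θ)
    ca = q c d a
    cb = q c d b
    -- Both q a b ca and q a b cb collapse to the common value of q a b c
    -- and q a b d modulo θ.
    collapse : ∀ {z w} → z ≡ q (q a b c) (q a b d) w → rel θ z (q a b c)
    collapse refl = q-agree θ abc∼abd _

  -- The kernel modulo θ of q a b, which consists of the pairs to which
  -- (a , b) is orthogonal.
  kernel : Congruence A → Carrier A → Carrier A → Congruence A
  kernel θ a b = record
    { rel           = λ u v → rel θ (q a b u) (q a b v)
    ; isEquivalence = record
      { refl = rel-refl θ ; sym = rel-sym θ ; trans = rel-trans θ }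
    ; compatible    = λ f {xs} {ys} xs∼ys →
        rel-trans θ (rel-reflexive θ (sym (absorb f a b xs)))
          (rel-trans θ
            (q-cong θ (rel-refl θ) (rel-refl θ) (compatible θ f
              (Pointwise.map⁺ {_∼₁_ = λ u v → rel θ (q a b u) (q a b v)} {_∼₂_ = rel θ} id xs∼ys)))
            (rel-reflexive θ (absorb f a b ys)))
    }

  -- The pairs to which every pair in γ is orthogonal modulo θ.
  polar : Congruence A → Congruence A → Congruence A
  polar θ γ = record
    { rel           = λ u v → ∀ {c d} → rel γ c d → rel θ (q c d u) (q c d v)
    ; isEquivalence = record
      { refl  = λ _ → rel-refl θ
      ; sym   = λ u∼v cγd → rel-sym θ (u∼v cγd)
      ; trans = λ u∼v v∼w cγd → rel-trans θ (u∼v cγd) (v∼w cγd) }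
    ; compatible    = λ f xs∼ys {c} {d} cγd →
        compatible (kernel θ c d) f (Pointwise.map (λ u∼v → u∼v cγd) xs∼ys)
    }

  -- If (a , b) is not in σ, then σ is the meet of the kernel γ of q a b and
  -- of the polar of γ: a pair (u , v) in both is orthogonal to itself, so
  -- that u = q u v u and v = q u v v are σ-related.  By symmetry the polar
  -- contains (a , b), so it is not σ; hence σ = γ, and γ contains
  -- (q a b c , c) because q a b is idempotent.
  meetIrreducible⇒discriminates : ∀ σ → σ ∈ MeetIrreducible → Discriminates σ
  meetIrreducible⇒discriminates σ (σ-proper , irreducible) = record
    { proper = σ-proper ; discern = discern′ }
    where
    discern′ : ∀ {a b} → ¬ rel σ a b → ∀ c → rel σ (q a b c) c
    discern′ {a} {b} ¬σab c with irreducible γ δ (σ⊆γ∩δ , γ∩δ⊆σ)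
      where
      γ δ : Congruence A
      γ = kernel σ a b
      δ = polar σ γ
      σ⊆γ∩δ : rel σ ⇒ (rel γ ∩ rel δ)
      σ⊆γ∩δ uσv = q-cong σ (rel-refl σ) (rel-refl σ) uσv
                , λ _ → q-cong σ (rel-refl σ) (rel-refl σ) uσv
      γ∩δ⊆σ : (rel γ ∩ rel δ) ⇒ rel σ
      γ∩δ⊆σ {u} {v} (uγv , uδv) =
        rel-trans σ (rel-reflexive σ (sym (aba u v)))
          (rel-trans σ (uδv uγv) (rel-reflexive σ (abb u v)))
    ... | inj₁ (_ , γ⊆σ) = γ⊆σ (rel-reflexive σ (idem a b c))
    ... | inj₂ (_ , δ⊆σ) = contradiction (δ⊆σ λ {c} {d} → orthogonal-sym σ) ¬σab

  -- Meet-primeness and the Chinese remainder theorem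

  -- If no θ j lies below σ, neither does their meet.  If (c , d) is in the
  -- first congruence but not in σ, then q c d is constant modulo the first
  -- congruence and the identity modulo σ, and it preserves all the others.
  meet-not-below : Discriminates σ → (θ : Fin k → Congruence A) → (∀ j → ¬ (rel (θ j) ⇒ rel σ)) →
           ∃₂ λ x y → ⋂ θ x y × ¬ rel σ x y
  meet-not-below {σ} {ℕ.zero} Dσ θ θ⊈σ = dne λ none →
    proper Dσ λ x y → dne λ ¬σxy → none (x , y , (λ ()) , ¬σxy)
  meet-not-below {σ} {ℕ.suc k} Dσ θ θ⊈σ = dne λ none → θ⊈σ Fin.zero λ {c} {d} cθd → dne λ ¬σcd →
    case meet-not-below Dσ (θ ∘ Fin.suc) (θ⊈σ ∘ Fin.suc) of λ { (x , y , ⋂xy , ¬σxy) →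
      none (q c d x , q c d y
           , (λ { Fin.zero → rel-trans (θ Fin.zero) (q-agree (θ Fin.zero) cθd x)
                               (rel-sym (θ Fin.zero) (q-agree (θ Fin.zero) cθd y))
                ; (Fin.suc j) → let θⱼ = θ (Fin.suc j) in
                    q-cong θⱼ (rel-refl θⱼ) (rel-refl θⱼ) (⋂xy j) })
           , λ p → ¬σxy (rel-trans σ (rel-sym σ (discern Dσ ¬σcd x))
                          (rel-trans σ p (discern Dσ ¬σcd y)))) }

  meet-prime : Discriminates σ → (θ : Fin k → Congruence A) → ⋂ θ ⇒ rel σ → ∃[ j ] (rel (θ j) ⇒ rel σ)
  meet-prime {σ} Dσ θ ⋂θ⊆σ = dne {P = ∃[ j ] (rel (θ j) ⇒ rel σ)} λ none →
    case meet-not-below Dσ θ (λ j θj⊆σ → none (j , λ {x} {y} → θj⊆σ {x} {y})) of λ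
      { (_ , _ , ⋂xy , ¬σxy) → ¬σxy (⋂θ⊆σ ⋂xy) }

  -- The Chinese remainder theorem for algebras with a majority term: a
  -- system of congruences whose members are solvable in pairs is solvable.
  -- The index type I may be infinite, as A is finite.
  module _ {I : Set (suc ℓ)} (σ : I → Congruence A) (a : I → Carrier A)
           (pairwise : ∀ i j → (rel (σ i) ∘ᵣ rel (σ j)) (a i) (a j)) where

    private
      Solves : Carrier A → Pred I ℓ
      Solves x i = rel (σ i) x (a i)

      majority : ∀ {x y z} i →
                 Solves x i × Solves y i ⊎ Solves x i × Solves z i ⊎ Solves y i × Solves z i →
                 Solves (q x y z) i
      majority i (inj₁ (p , r)) =
        rel-trans (σ i) (q-cong (σ i) p r (rel-refl (σ i))) (rel-reflexive (σ i) (aac _ _))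
      majority i (inj₂ (inj₁ (p , r))) =
        rel-trans (σ i) (q-cong (σ i) p (rel-refl (σ i)) r) (rel-reflexive (σ i) (aba _ _))
      majority i (inj₂ (inj₂ (p , r))) =
        rel-trans (σ i) (q-cong (σ i) (rel-refl (σ i)) p r) (rel-reflexive (σ i) (abb _ _))

    -- A solution for i, j, l and a list is the majority of the solutions
    -- that leave out l, j and i respectively.
    solveList : (is : List I) → ∀ i j → ∃[ x ] (Solves x i × Solves x j × All (Solves x) is)
    solveList [] i j with pairwise i j
    ... | x , aᵢσx , xσaⱼ = x , rel-sym (σ i) aᵢσx , xσaⱼ , []
    solveList (l ∷ is) i j with solveList is i j | solveList is i l | solveList is j l
    ... | x , xi , xj , xs | y , yi , yl , ys | z , zj , zl , zs =
      q x y z , majority i (inj₁ (xi , yi)) , majority j (inj₂ (inj₁ (xj , zj)))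
      , majority l (inj₂ (inj₂ (yl , zl)))
      ∷ All.zipWith (λ { {i} (p , r) → majority i (inj₁ (p , r)) }) (xs , ys)

    -- If there were no solution, each of the finitely many elements of A would
    -- violate some constraint, and these constraints are solvable together.
    -- The given element matters only if I is empty.
    chineseRemainder : Finite A → Carrier A → ∃[ x ] (∀ i → Solves x i)
    chineseRemainder fin x₀ = em⇒dne em⁺ λ none →
      let unsolved : ∀ x → Σ[ i ∈ I ] ¬ Solves x i
          unsolved x = em⇒dne em⁺ λ ¬∃ → none (x , λ i → dne λ ¬xi → ¬∃ (i , ¬xi))
          L , ∈L = elements A fin
          i₀ = proj₁ (unsolved x₀)
          x , _ , _ , all = solveList (List.map (proj₁ ∘ unsolved) L) i₀ i₀
      in proj₂ (unsolved x) (All.lookup all (∈-map⁺ (proj₁ ∘ unsolved) (∈L x)))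

  -- Products of two meet-irreducible congruences

  -- Distinct discriminating congruences are incomparable, since the quotient
  -- by such a congruence is simple.
  incomparable : Discriminates λ′ → Discriminates μ → ¬ (rel λ′ ≑ rel μ) →
                 ∃₂ λ c d → rel λ′ c d × ¬ rel μ c d
  incomparable {λ′} {μ} Dλ Dμ λ≠μ = dne λ none →
    let λ⊆μ : rel λ′ ⇒ rel μ
        λ⊆μ = λ {c} {d} cλd → dne λ ¬cμd → none (c , d , cλd , ¬cμd)
    in λ≠μ (λ⊆μ , λ {x} {y} xμy → dne λ ¬xλy → proper Dμ λ z w →
         let xμ_ : ∀ z → rel μ x z
             xμ z = rel-trans μ (q-fix μ xμy z) (λ⊆μ (discern Dλ ¬xλy z))
         in rel-trans μ (rel-sym μ (xμ z)) (xμ w))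

  -- A λ′-class that is not inside a single μ-class meets every μ-class.
  class-meets : (λ′ μ : Congruence A) → Discriminates μ → ∀ {c d} → rel λ′ c d → ¬ rel μ c d →
          ∀ x → (rel λ′ ∘ᵣ rel μ) c x
  class-meets λ′ μ Dμ {c} {d} cλd ¬cμd x = q c d x , q-fix λ′ cλd x , discern Dμ ¬cμd x

  -- The λ′-class of u is contained in the μ-class of u.
  _⊆[_]_ : Congruence A → Carrier A → Congruence A → Set ℓ
  λ′ ⊆[ u ] μ = ∀ {z} → rel λ′ u z → rel μ u z

  -- In particular, once some y is not reached from x through λ′ ∘ μ, the
  -- λ′-class of x lies in the μ-class of x.
  unrelated⇒class-inclusion : (λ′ μ : Congruence A) → Discriminates μ → ∀ {x y} →
            ¬ (rel λ′ ∘ᵣ rel μ) x y → λ′ ⊆[ x ] μ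
  unrelated⇒class-inclusion λ′ μ Dμ ¬xy xλz = dne λ ¬xμz → ¬xy (class-meets λ′ μ Dμ xλz ¬xμz _)

  no-shared-class : Discriminates μ → Discriminates σ → ¬ (rel μ ≑ rel σ) →
                    ∀ u → σ ⊆[ u ] μ → ¬ (μ ⊆[ u ] σ)
  no-shared-class {μ} {σ} Dμ Dσ μ≠σ u σ⊆μ μ⊆σ with incomparable Dμ Dσ μ≠σ
  ... | c , d , cμd , ¬cσd = ¬cσd (rel-trans σ (rel-sym σ (μ⊆σ uμc)) (μ⊆σ (rel-trans μ uμc cμd)))
    where
    uμc : rel μ u c
    uμc = rel-trans μ (σ⊆μ (rel-sym σ (discern Dσ ¬cσd u))) (q-agree μ cμd u)

  -- If neither product is full at u, the elements reached from u form the
  -- μ-class of u and the σ-class of u respectively, so that equal products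
  -- would make μ and σ share a class.
  distinct-products : Discriminates μ → Discriminates σ → ¬ (rel μ ≑ rel σ) →
                      ∀ {u v w} → ¬ (rel λ′ ∘ᵣ rel μ) u v → ¬ (rel λ′ ∘ᵣ rel σ) u w →
                      ¬ ((rel λ′ ∘ᵣ rel μ) ≑ (rel λ′ ∘ᵣ rel σ))
  distinct-products {μ} {σ} {λ′} Dμ Dσ μ≠σ {u} ¬uv ¬uw (λμ⊆λσ , λσ⊆λμ) =
    no-shared-class Dμ Dσ μ≠σ u
      (λ uσz → absorbˡ μ Dμ ¬uv (λσ⊆λμ (u , rel-refl λ′ , uσz)))
      (λ uμz → absorbˡ σ Dσ ¬uw (λμ⊆λσ (u , rel-refl λ′ , uμz)))
    where
    absorbˡ : (κ : Congruence A) → Discriminates κ → ∀ {v z} →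
              ¬ (rel λ′ ∘ᵣ rel κ) u v → (rel λ′ ∘ᵣ rel κ) u z → rel κ u z
    absorbˡ κ Dκ ¬uv (y , uλy , yκz) = rel-trans κ (unrelated⇒class-inclusion λ′ κ Dκ ¬uv uλy) yκz

  -- There are c and d that are λ′-related but not μ-related.  Each of them
  -- reaches everything through λ′ ∘ μ, which is symmetric since λ′ and μ
  -- permute, and is therefore reached from x.  If some y were not reached
  -- from x, then both would lie in the μ-class of x.
  permuting⇒full : Discriminates λ′ → Discriminates μ → ¬ (rel λ′ ≑ rel μ) →
                   (rel λ′ ∘ᵣ rel μ) ≑ (rel μ ∘ᵣ rel λ′) → ∀ x y → (rel λ′ ∘ᵣ rel μ) x y
  permuting⇒full {λ′} {μ} Dλ Dμ λ≠μ (_ , μλ⊆λμ) x y with incomparable Dλ Dμ λ≠μ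
  ... | c , d , cλd , ¬cμd = dne λ ¬xy →
    let xμ_ : ∀ {e} → (rel λ′ ∘ᵣ rel μ) e x → rel μ x e
        xμ_ ex = case μλ⊆λμ (∘-converse λ′ μ ex) of λ
          { (z , xλz , zμe) → rel-trans μ (unrelated⇒class-inclusion λ′ μ Dμ ¬xy xλz) zμe }
        xμc = xμ class-meets λ′ μ Dμ cλd ¬cμd x
        xμd = xμ class-meets λ′ μ Dμ (rel-sym λ′ cλd) (¬cμd ∘ rel-sym μ) x
    in ¬cμd (rel-trans μ (rel-sym μ xμc) xμd)

  -- If the λ′-class of u lies in the μ-class of u, then A is the union of
  -- this μ-class and of a λ′-class which meets every μ-class.
  cover : Discriminates λ′ → Discriminates μ → ¬ (rel λ′ ≑ rel μ) → ∀ {u} → λ′ ⊆[ u ] μ →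
          ∃[ c ] ((∀ x → (rel λ′ ∘ᵣ rel μ) c x) × (∀ {x} → ¬ rel λ′ c x → rel μ u x))
  cover {λ′} {μ} Dλ Dμ λ≠μ {u} λ⊆μ with incomparable Dλ Dμ λ≠μ
  ... | c , d , cλd , ¬cμd = c , class-meets λ′ μ Dμ cλd ¬cμd , outside
    where
    outside : ∀ {x} → ¬ rel λ′ c x → rel μ u x
    outside {x} ¬cλx with class-meets λ′ μ Dμ cλd ¬cμd x
    ... | p , cλp , pμx =
      let ¬xλp = λ xλp → ¬cλx (rel-trans λ′ cλp (rel-sym λ′ xλp))
      in rel-trans μ (λ⊆μ (rel-sym λ′ (discern Dλ ¬xλp u))) (q-agree μ (rel-sym μ pμx) u)

  -- Suppose that neither (u , v) nor (x , y) is in λ′ ∘ μ, and that σ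
  -- contains the λ′-class of u but separates u from v.  By cover, A is the
  -- union of the σ-class of u and a λ′-class; v lies in the latter.  If x
  -- also did, x would be μ-related to everything in that λ′-class, which
  -- contains v and, by cover for μ, meets the μ-class of u; so u and v would
  -- be μ-related, and (u , v) would be in λ′ ∘ μ.
  outside-product : Discriminates λ′ → Discriminates μ → Discriminates σ →
          ¬ (rel λ′ ≑ rel μ) → ¬ (rel λ′ ≑ rel σ) →
          ∀ {u v} → ¬ (rel λ′ ∘ᵣ rel μ) u v → λ′ ⊆[ u ] σ → ¬ rel σ u v →
          ∀ {x y} → ¬ (rel λ′ ∘ᵣ rel μ) x y → rel σ u x
  outside-product {λ′} {μ} {σ} Dλ Dμ Dσ λ≠μ λ≠σ {u} {v} ¬uv λ⊆σ ¬uσv {x} {y} ¬xy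
    with cover Dλ Dσ λ≠σ λ⊆σ | cover Dλ Dμ λ≠μ (unrelated⇒class-inclusion λ′ μ Dμ ¬uv)
  ... | c , _ , outsideσ | c′ , meets , outsideμ = outsideσ λ cλx →
    let cλv  = dne λ ¬cλv → ¬uσv (outsideσ ¬cλv)
        xλv  = rel-trans λ′ (rel-sym λ′ cλx) cλv
        xμv  = unrelated⇒class-inclusion λ′ μ Dμ ¬xy xλv
        c′λv = dne λ ¬c′λv → ¬uv (u , rel-refl λ′ , outsideμ ¬c′λv)
        p , c′λp , pμu = meets u
        xλp  = rel-trans λ′ xλv (rel-trans λ′ (rel-sym λ′ c′λv) c′λp)
        xμp  = unrelated⇒class-inclusion λ′ μ Dμ ¬xy xλp
        uμv  = rel-trans μ (rel-sym μ pμu) (rel-trans μ (rel-sym μ xμp) xμv)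
    in ¬uv (u , rel-refl λ′ , uμv)

  -- The key step.  If σ and τ contain the λ′-class of u and the μ-class of v
  -- respectively, where (u , v) is not in λ′ ∘ μ, and if no element is both
  -- σ-related to u and τ-related to v, then σ is contained in λ′ ∘ μ.
  product-above : Discriminates λ′ → Discriminates μ → Discriminates σ → Discriminates τ →
            ¬ (rel λ′ ≑ rel μ) → ¬ (rel λ′ ≑ rel σ) → ¬ (rel μ ≑ rel τ) →
            ∀ {u v} → ¬ (rel λ′ ∘ᵣ rel μ) u v → λ′ ⊆[ u ] σ → μ ⊆[ v ] τ →
            ¬ (rel σ ∘ᵣ rel τ) u v → rel σ ⇒ (rel λ′ ∘ᵣ rel μ)
  product-above {λ′} {μ} {σ} {τ} Dλ Dμ Dσ Dτ λ≠μ λ≠σ μ≠τ {u} {v} ¬uv λ⊆σ μ⊆τ ¬στ {x} {y} xσy =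
    dne λ ¬xy →
    let uσx = outside-product Dλ Dμ Dσ λ≠μ λ≠σ ¬uv λ⊆σ
                (λ uσv → ¬στ (v , uσv , rel-refl τ)) ¬xy
        vτy = outside-product Dμ Dλ Dτ (λ≠μ ∘ swap) μ≠τ (¬uv ∘ ∘-converse μ λ′) μ⊆τ
                (λ vτu → ¬στ (u , rel-refl σ , rel-sym τ vτu)) (¬xy ∘ ∘-converse μ λ′)
    in ¬στ (y , rel-trans σ uσx xσy , rel-sym τ vτy)

  -- From the Chinese Remainder property to pairs

  -- If λ′ ∘ μ is not full and contains none of the congruences σ i, then some
  -- pair (u , v) outside λ′ ∘ μ is in all the σ i.  The pair is found inside
  -- the λ′-class of u₀ and the μ-class of v₀, so that it suffices to find a
  -- centre e to which all the σ i relate both u and v.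
  module _ (fin : Finite A)
           (Dλ : Discriminates λ′) (Dμ : Discriminates μ) (λ≠μ : ¬ (rel λ′ ≑ rel μ))
           {I : Set (suc ℓ)} (σ : I → Congruence A) (D : ∀ i → Discriminates (σ i))
           (σ≠λ : ∀ i → ¬ (rel (σ i) ≑ rel λ′)) (σ≠μ : ∀ i → ¬ (rel (σ i) ≑ rel μ))
           (σ⊈λμ : ∀ i → ¬ (rel (σ i) ⇒ (rel λ′ ∘ᵣ rel μ)))
           {u₀ v₀ : Carrier A} (¬u₀v₀ : ¬ (rel λ′ ∘ᵣ rel μ) u₀ v₀) where

    private
      -- The centre e has to be σ i-related to u₀ if σ i contains the whole
      -- λ′-class of u₀, and likewise for v₀ and μ; otherwise the σ i-class
      -- of e is unconstrained.
      Forcedˡ Forcedʳ : Set (suc ℓ)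
      Forcedˡ = Σ[ i ∈ I ] (λ′ ⊆[ u₀ ] σ i)
      Forcedʳ = Σ[ i ∈ I ] (μ ⊆[ v₀ ] σ i)

      modulus : Forcedˡ ⊎ Forcedʳ → Congruence A
      modulus = Sum.[ σ ∘ proj₁ , σ ∘ proj₁ ]

      residue : Forcedˡ ⊎ Forcedʳ → Carrier A
      residue = Sum.[ const u₀ , const v₀ ]

      opposite : (s : Forcedˡ) (t : Forcedʳ) →
                 (rel (modulus (inj₁ s)) ∘ᵣ rel (modulus (inj₂ t))) u₀ v₀
      opposite (i , λ⊆σ) (j , μ⊆τ) = dne λ ¬στ → σ⊈λμ i
        (product-above Dλ Dμ (D i) (D j) λ≠μ (σ≠λ i ∘ swap) (σ≠μ j ∘ swap) ¬u₀v₀ λ⊆σ μ⊆τ ¬στ)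

      pairwise : ∀ s t → (rel (modulus s) ∘ᵣ rel (modulus t)) (residue s) (residue t)
      pairwise s@(inj₁ _) t@(inj₁ _) = u₀ , rel-refl (modulus s) , rel-refl (modulus t)
      pairwise   (inj₁ s)   (inj₂ t) = opposite s t
      pairwise s@(inj₂ y) t@(inj₁ x) = ∘-converse (modulus t) (modulus s) (opposite x y)
      pairwise s@(inj₂ _) t@(inj₂ _) = v₀ , rel-refl (modulus s) , rel-refl (modulus t)

      -- From a suitable centre e, an element of the κ-class of w that is
      -- σ i-related to e for all i.  The constraint nothing is that of κ.
      attach : (κ : Congruence A) (w e : Carrier A) →
               (∀ i → κ ⊆[ w ] σ i → rel (σ i) e w) →
               ∃[ u ] (rel κ u w × (∀ i → rel (σ i) u e))
      attach κ w e forced = case chineseRemainder moduli residues pairs fin w of λ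
        { (u , solves) → u , solves nothing , solves ∘ just }
        where
        moduli : Maybe I → Congruence A
        moduli = maybe σ κ
        residues : Maybe I → Carrier A
        residues = maybe (const e) w
        near : ∀ i → (rel κ ∘ᵣ rel (σ i)) w e
        near i = dne λ ¬we → ¬we
          (w , rel-refl κ , rel-sym (σ i) (forced i (unrelated⇒class-inclusion κ (σ i) (D i) ¬we)))
        pairs : ∀ s t → (rel (moduli s) ∘ᵣ rel (moduli t)) (residues s) (residues t)
        pairs nothing  nothing  = w , rel-refl κ , rel-refl κ
        pairs nothing  (just i) = near i
        pairs (just i) nothing  = ∘-converse κ (σ i) (near i)
        pairs (just i) (just j) = e , rel-refl (σ i) , rel-refl (σ j)

    common-pair : ∃₂ λ u v → ¬ (rel λ′ ∘ᵣ rel μ) u v × (∀ i → rel (σ i) u v)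
    common-pair with chineseRemainder modulus residue pairwise fin u₀
    ... | e , e-solves with attach λ′ u₀ e (λ i λ⊆σ → e-solves (inj₁ (i , λ⊆σ)))
                          | attach μ v₀ e (λ i μ⊆σ → e-solves (inj₂ (i , μ⊆σ)))
    ... | u , uλu₀ , uσe | v , vμv₀ , vσe =
      u , v
      , (λ { (z , uλz , zμv) → ¬u₀v₀
            (z , rel-trans λ′ (rel-sym λ′ uλu₀) uλz , rel-trans μ zμv vμv₀) })
      , (λ i → rel-trans (σ i) (uσe i) (rel-sym (σ i) (vσe i)))

  module _ (fin : Finite A) {k : ℕ} (θ : Fin k → Congruence A) where

    private
      Σθ : Pred (Congruence A) (suc ℓ)
      Σθ = MeetIrreducibleAbove θ

    -- If (u , v) is in all the members of Σθ other than λ′ and μ but not in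
    -- λ′ ∘ μ, the tuple which is u at those j with θ j below λ′ and v at the
    -- others satisfies the hypothesis of the Chinese Remainder property.  A
    -- solution would put (u , v) into λ′ ∘ μ.
    module _ (cr : IsCRTuple θ) (λ-above : λ′ ∈ Σθ) (μ-above : μ ∈ Σθ)
             (θ⊈λ∩μ : ∀ j → ¬ (rel (θ j) ⇒ (rel λ′ ∩ rel μ)))
             {u v : Carrier A} (¬uv : ¬ (rel λ′ ∘ᵣ rel μ) u v)
             (others : ∀ σ → σ ∈ Σθ → ¬ (rel σ ≑ rel λ′) → ¬ (rel σ ≑ rel μ) → rel σ u v) where

      private
        Choice : Fin k → Pred (Carrier A) ℓ
        Choice j x = (rel (θ j) ⇒ rel λ′) × x ≡ u ⊎ ¬ (rel (θ j) ⇒ rel λ′) × x ≡ v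

        choice : ∀ j → ∃[ x ] Choice j x
        choice j with em {rel (θ j) ⇒ rel λ′}
        ... | yes θ⊆λ = u , inj₁ ((λ {x} {y} → θ⊆λ {x} {y}) , refl)
        ... | no  θ⊈λ = v , inj₂ (θ⊈λ , refl)

        -- A member of Σθ above both θ i and θ j is not λ′ since θ j is not
        -- below λ′, and not μ since θ i is below λ′ and hence not below μ.
        mixed : ∀ i j → rel (θ i) ⇒ rel λ′ → ¬ (rel (θ j) ⇒ rel λ′) → (θ i ∨ θ j) u v
        mixed i j θᵢ⊆λ θⱼ⊈λ = dne λ ¬join →
          case separate em⁺ A fin (joinCongruence (θ i) (θ j)) ¬join of λ
            { (σ , σ-mi , join⊆σ , ¬σuv) → ¬σuv (others σ
                (σ-mi , λ h → join⊆σ [ inj₁ (h i) ])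
                (λ σ≑λ → θⱼ⊈λ λ p → proj₁ σ≑λ (join⊆σ [ inj₂ p ]))
                (λ σ≑μ → θ⊈λ∩μ i λ p → θᵢ⊆λ p , proj₁ σ≑μ (join⊆σ [ inj₁ p ]))) }

        linked : ∀ i j {x y} → Choice i x → Choice j y → (θ i ∨ θ j) x y
        linked i j (inj₁ (_ , refl))    (inj₁ (_ , refl))    = [ inj₁ (rel-refl (θ i)) ]
        linked i j (inj₁ (θᵢ⊆λ , refl)) (inj₂ (θⱼ⊈λ , refl)) = mixed i j θᵢ⊆λ θⱼ⊈λ
        linked i j (inj₂ (θᵢ⊈λ , refl)) (inj₁ (θⱼ⊆λ , refl)) = rel-sym join
          (join-least (θ j) (θ i) join (λ p → [ inj₂ p ]) (λ p → [ inj₁ p ]) (mixed j i θⱼ⊆λ θᵢ⊈λ))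
          where join = joinCongruence (θ i) (θ j)
        linked i j (inj₂ (_ , refl))    (inj₂ (_ , refl))    = [ inj₁ (rel-refl (θ i)) ]

      common-pair⇒¬crTuple : ⊥
      common-pair⇒¬crTuple with cr (proj₁ ∘ choice)
                              (λ i j → linked i j (proj₂ (choice i)) (proj₂ (choice j)))
                         | meet-prime (meetIrreducible⇒discriminates λ′ (proj₁ λ-above)) θ (proj₂ λ-above)
                         | meet-prime (meetIrreducible⇒discriminates μ (proj₁ μ-above)) θ (proj₂ μ-above)
      ... | b , solves | i , θᵢ⊆λ | j , θⱼ⊆μ = ¬uv
        ( b
        , rel-sym λ′ (atλ (proj₂ (choice i)) (solves i))
        , atμ (proj₂ (choice j)) (solves j) )
        where
        atλ : ∀ {x} → Choice i x → rel (θ i) b x → rel λ′ b u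
        atλ (inj₁ (_ , refl)) bθu = θᵢ⊆λ bθu
        atλ (inj₂ (θᵢ⊈λ , _)) _   = ⊥-elim (θᵢ⊈λ θᵢ⊆λ)
        atμ : ∀ {x} → Choice j x → rel (θ j) b x → rel μ b v
        atμ (inj₁ (θⱼ⊆λ , _)) _   = ⊥-elim (θ⊈λ∩μ j λ p → θⱼ⊆λ p , θⱼ⊆μ p)
        atμ (inj₂ (_ , refl)) bθv = θⱼ⊆μ bθv

    crTuple⇒pairCondition : IsCRTuple θ → ∀ λ′ μ → λ′ ∈ Σθ → μ ∈ Σθ → PairCondition θ λ′ μ
    crTuple⇒pairCondition cr λ′ μ λ-above μ-above = em⇒dne em⁺ refute
      where
      Dλ = meetIrreducible⇒discriminates λ′ (proj₁ λ-above)
      Dμ = meetIrreducible⇒discriminates μ (proj₁ μ-above)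

      equal⇒permute : rel λ′ ≑ rel μ → (rel λ′ ∘ᵣ rel μ) ≑ (rel μ ∘ᵣ rel λ′)
      equal⇒permute (λ⊆μ , μ⊆λ) =
          (λ { (z , xλz , zμy) → z , λ⊆μ xλz , μ⊆λ zμy })
        , (λ { (z , xμz , zλy) → z , μ⊆λ xμz , λ⊆μ zλy })

      full⇒permute : (∀ x y → (rel λ′ ∘ᵣ rel μ) x y) → (rel λ′ ∘ᵣ rel μ) ≑ (rel μ ∘ᵣ rel λ′)
      full⇒permute full = (λ _ → ∘-converse λ′ μ (full _ _)) , (λ _ → full _ _)

      refute : ¬ ¬ PairCondition θ λ′ μ
      refute fails = fails (inj₁ (full⇒permute λ u₀ v₀ → dne λ ¬u₀v₀ →
        case common-pair fin Dλ Dμ (fails ∘ inj₁ ∘ equal⇒permute)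
               {I = Σ[ σ ∈ Congruence A ] (σ ∈ Σθ × ¬ (rel σ ≑ rel λ′) × ¬ (rel σ ≑ rel μ))}
               proj₁
               (λ { (σ , (σ-mi , _) , _) → meetIrreducible⇒discriminates σ σ-mi })
               (λ { (_ , _ , σ≠λ , _) → σ≠λ }) (λ { (_ , _ , _ , σ≠μ) → σ≠μ })
               (λ { (σ , σ∈Σ , σ≠λ , σ≠μ) σ⊆ → fails (inj₂ (inj₁ (σ , σ∈Σ , σ≠λ , σ≠μ , σ⊆))) })
               ¬u₀v₀
        of λ { (u , v , ¬uv , related) →
          common-pair⇒¬crTuple {λ′} {μ} cr λ-above μ-above
            (λ j θⱼ⊆ → fails (inj₂ (inj₂ (j , θⱼ⊆)))) ¬uv
            (λ σ σ∈Σ σ≠λ σ≠μ → related (σ , σ∈Σ , σ≠λ , σ≠μ)) }))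

    -- From pairs to the Chinese Remainder property

    pairCondition⇒crTuple : Carrier A →
      (∀ λ′ μ → λ′ ∈ Σθ → μ ∈ Σθ → PairCondition θ λ′ μ) → IsCRTuple θ
    pairCondition⇒crTuple x₀ pairCondition a joined =
      case chineseRemainder modulus residue pairwise fin x₀ of λ
        { (x , solves) → x , λ j → dne λ ¬xθa →
            case separate em⁺ A fin (θ j) ¬xθa of λ
              { (σ , σ-mi , θ⊆σ , ¬xσa) → ¬xσa (solves (σ , j , σ-mi , θ⊆σ)) } }
      where
      -- The system to be solved: for each j and each meet-irreducible σ above
      -- θ j, the solution is to be σ-related to a j.  Two unsolvable
      -- constraints are a conflict, and a conflict with an inclusion-minimal
      -- product of its moduli is shown to be impossible.
      Constraint : Set (suc ℓ)
      Constraint = Σ[ σ ∈ Congruence A ] Σ[ j ∈ Fin k ] (σ ∈ MeetIrreducible × rel (θ j) ⇒ rel σ)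

      modulus : Constraint → Congruence A
      modulus (σ , _) = σ

      residue : Constraint → Carrier A
      residue (_ , j , _) = a j

      D : ∀ s → Discriminates (modulus s)
      D (σ , _ , σ-mi , _) = meetIrreducible⇒discriminates σ σ-mi

      above : ∀ s → modulus s ∈ Σθ
      above (_ , j , σ-mi , θ⊆σ) = σ-mi , λ h → θ⊆σ (h j)

      residue-near : ∀ s j → rel (θ j) ⇒ rel (modulus s) → rel (modulus s) (residue s) (a j)
      residue-near (σ , i , _ , θᵢ⊆σ) j θⱼ⊆σ = join-least (θ i) (θ j) σ θᵢ⊆σ θⱼ⊆σ (joined i j)

      Product : Constraint → Constraint → Rel (Carrier A) ℓ
      Product s t = rel (modulus s) ∘ᵣ rel (modulus t)

      Conflict : Constraint → Constraint → Set ℓ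
      Conflict s t = ¬ Product s t (residue s) (residue t)

      module _ {s t : Constraint} (¬st : Conflict s t)
               (st-minimal : ∀ s′ t′ → Conflict s′ t′ → Product s′ t′ ⇒ Product s t →
                             Product s t ⇒ Product s′ t′) where

        -- By minimality a conflict of m with s or t would have the same product
        -- as the conflict of s with t, contrary to distinct-products.  Hence m is
        -- solvable together with each of them, and the two solutions combine to
        -- one of s and t.
        intermediate : (m : Constraint) → ¬ (rel (modulus m) ≑ rel (modulus s)) →
                       ¬ (rel (modulus m) ≑ rel (modulus t)) →
                       ¬ (rel (modulus m) ⇒ Product s t)
        intermediate m m≠s m≠t m⊆st = case dne sm , dne mt of λ
          { ((_ , szˡ , zˡm) , (_ , mzʳ , zʳt)) →
            case m⊆st (rel-trans (modulus m) zˡm mzʳ) of λ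
              { (y , zˡy , yzʳ) →
                ¬st (y , rel-trans (modulus s) szˡ zˡy , rel-trans (modulus t) yzʳ zʳt) } }
          where
          sm⊆st : Product s m ⇒ Product s t
          sm⊆st (_ , p , r) = case m⊆st r of λ { (y , p′ , r′) → y , rel-trans (modulus s) p p′ , r′ }
          mt⊆st : Product m t ⇒ Product s t
          mt⊆st (_ , p , r) = case m⊆st p of λ { (y , p′ , r′) → y , p′ , rel-trans (modulus t) r′ r }

          sm : ¬ Conflict s m
          sm ¬sm = distinct-products {λ′ = modulus s} (D t) (D m) (m≠t ∘ swap) ¬st ¬sm
            (st-minimal s m ¬sm sm⊆st , sm⊆st)

          mt : ¬ Conflict m t
          mt ¬mt = distinct-products {λ′ = modulus t} (D s) (D m) (m≠s ∘ swap)
            (¬st ∘ ∘-converse (modulus t) (modulus s)) (¬mt ∘ ∘-converse (modulus t) (modulus m))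
            ( (λ ts → ∘-converse (modulus m) (modulus t)
                (st-minimal m t ¬mt mt⊆st (∘-converse (modulus t) (modulus s) ts)))
            , (λ tm → ∘-converse (modulus s) (modulus t)
                (mt⊆st (∘-converse (modulus t) (modulus m) tm))) )

        no-minimal-conflict : ⊥
        no-minimal-conflict with em {rel (modulus s) ≑ rel (modulus t)}
        ... | yes (_ , t⊆s) = ¬st
          ( _ , residue-near s (proj₁ (proj₂ t)) (λ p → t⊆s (proj₂ (proj₂ (proj₂ t)) p))
          , rel-refl (modulus t) )
        ... | no s≠t with pairCondition (modulus s) (modulus t) (above s) (above t)
        ...   | inj₁ permute = ¬st (permuting⇒full (D s) (D t) s≠t permute _ _)
        ...   | inj₂ (inj₂ (l , θ⊆)) = ¬st
          (a l , residue-near s l (proj₁ ∘ θ⊆) , rel-sym (modulus t) (residue-near t l (proj₂ ∘ θ⊆)))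
        ...   | inj₂ (inj₁ (σ , (σ-mi , ⋂θ⊆σ) , σ≠s , σ≠t , σ⊆st))
          with meet-prime (meetIrreducible⇒discriminates σ σ-mi) θ ⋂θ⊆σ
        ...     | l , θ⊆σ = intermediate (σ , l , σ-mi , θ⊆σ) σ≠s σ≠t σ⊆st

      pairwise : ∀ s t → Product s t (residue s) (residue t)
      pairwise s₀ t₀ = dne λ ¬s₀t₀ →
        let L , ∈L = elements A fin
            (s , t , ¬st) , st-minimal = minimal em⁺ (cartesianProduct L L)
              {Σ[ s ∈ Constraint ] Σ[ t ∈ Constraint ] Conflict s t}
              (λ { (s , t , _) (x , y) → Product s t x y }) (s₀ , t₀ , ¬s₀t₀)
        in no-minimal-conflict {s} {t} ¬st λ s′ t′ ¬s′t′ s′t′⊆st →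
             st-minimal (s′ , t′ , ¬s′t′) (λ _ → s′t′⊆st) (∈-cartesianProduct⁺ (∈L _) (∈L _))

theorem4p16 : {ℓ : Level} → ExcludedMiddle (suc ℓ) →
    (S : Signature ℓ) (V : Class S) → IsDualDiscriminatorVariety V →
    (A : Algebra S) → Finite A → A ∈ V →
    (k : ℕ) .{{_ : NonZero k}} (θ : Fin k → Congruence A) →
    IsCRTuple θ ⇔
    (∀ (λ′ μ : Congruence A) → λ′ ∈ MeetIrreducibleAbove θ → μ ∈ MeetIrreducibleAbove θ → PairCondition θ λ′ μ)
theorem4p16 em⁺ S V (K , t , V=⟨K⟩ , t-dd) A fin A∈V k θ =
  mk⇔ (crTuple⇒pairCondition fin θ)
      -- As k is nonzero, A is inhabited if there is a tuple at all.
      (λ pairs a → pairCondition⇒crTuple fin θ (a (Fin.fromℕ< (>-nonZero⁻¹ k))) pairs a)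
  where
  open DualDiscriminator em⁺ A (⟦ t ⟧₃ A)
         (variety-laws (lower-excludedMiddle em⁺) V=⟨K⟩ t t-dd A A∈V) (⟦⟧₃-cong t)
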